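{- (a) $\mathsf{EL}_{K,\Box,B}+(\mathrm{D}_B)$ is a sound and complete axiomatization of $\mathcal{L}_{K,\Box,B}$ with respect to the class of all topological subset spaces under e-d semantics for consistent e-d scenarios: for every $\varphi\in\mathcal{L}_{K,\Box,B}$, $\varphi$ is provable in $\mathsf{EL}_{K,\Box,B}+(\mathrm{D}_B)$ if and only if $(\mathcal{X},x,U,V)\models\varphi$ for every topological subset model $\mathcal{X}$ and every consistent e-d scenario $(x,U,V)$ of $\mathcal{X}$. (b) $\mathsf{EL}_{K,\Box,B}+(\mathrm{wF})$ is a sound and complete axiomatization of $\mathcal{L}_{K,\Box,B}$ with respect to the class of all topological subset spaces under e-d semantics for dense e-d scenarios: for every $\varphi\in\mathcal{L}_{K,\Box,B}$, $\varphi$ is provable in $\mathsf{EL}_{K,\Box,B}+(\mathrm{wF})$ if and only if $(\mathcal{X},x,U,V)\models\varphi$ for every topological subset model $\mathcal{X}$ and every dense e-d scenario $(x,U,V)$ of $\mathcal{X}$.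
   Context: Language. Fix a countable set PROP of primitive propositions. $\mathcal{L}_{K,\Box,B}$ is generated by $\varphi ::= p \mid \neg\varphi \mid \varphi\wedge\psi \mid K\varphi\mid\Box\varphi\mid B\varphi$, $p\in$ PROP. The connectives $\vee,\to,\leftrightarrow$ are defined as usual and $\Diamond:=\neg\Box\neg$. The logic $\mathsf{EL}_{K,\Box,B}$ is the Hilbert system (schemes and rules ranging over formulas of $\mathcal{L}_{K,\Box,B}$) consisting of classical propositional logic (with modus ponens) plus: the $\mathsf{S5}$ principles for $K$: $K(\varphi\to\psi)\to(K\varphi\to K\psi)$, $K\varphi\to\varphi$, $K\varphi\to KK\varphi$, $\neg K\varphi\to K\neg K\varphi$, and the rule "from $\vdash\varphi$ infer $\vdash K\varphi$"; the $\mathsf{S4}$ principles for $\Box$: $\Box(\varphi\to\psi)\to(\Box\varphi\to\Box\psi)$, $\Box\varphi\to\varphi$, $\Box\varphi\to\Box\Box\varphi$, and the rule "from $\vdash\varphi$ infer $\vdash\Box\varphi$"; the schemes $(\mathrm{KI})$ $K\varphi\to\Box\varphi$; $(\mathrm{K}_B)$ $B(\varphi\to\psi)\to(B\varphi\to B\psi)$; $(\mathrm{sPI})$ $B\varphi\to KB\varphi$; $(\mathrm{KB})$ $K\varphi\to B\varphi$; $(\mathrm{RB})$ $B\varphi\to B\Box\varphi$. Additional schemes: $(\mathrm{D}_B)$ $B\varphi\to\neg B\neg\varphi$; $(\mathrm{wF})$ $B\varphi\to\Diamond\varphi$. "$\mathsf{EL}_{K,\Box,B}+(\mathrm{A})$"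 denotes the system obtained by adding the scheme $(\mathrm{A})$. E-d semantics. A topological subset model is a triple $\mathcal{X}=(X,\mathcal{T},v)$ where $X$ is a nonempty set, $\mathcal{T}$ is a topology on $X$, and $v:\mathrm{PROP}\to 2^X$. An e-d scenario of $\mathcal{X}$ is a tuple $(x,U,V)$ with $x\in U$, $U,V\in\mathcal{T}$ and $V\subseteq U$ ($x\in V$ is not required). It is consistent if $V\neq\emptyset$, and dense if $U\subseteq\mathit{cl}(V)$. With $[\![\varphi]\!]^{U,V}=\{y\in U : (\mathcal{X},y,U,V)\models\varphi\}$ and $\mathit{int}$, $\mathit{cl}$ the interior and closure in $(X,\mathcal{T})$, truth is defined by: $(\mathcal{X},x,U,V)\models p$ iff $x\in v(p)$; the usual clauses for $\neg$ and $\wedge$; $(\mathcal{X},x,U,V)\models K\varphi$ iff $U=[\![\varphi]\!]^{U,V}$; $(\mathcal{X},x,U,V)\models\Box\varphi$ iff $x\in\mathit{int}([\![\varphi]\!]^{U,V})$; $(\mathcal{X},x,U,V)\models B\varphi$ iff $V\subseteq[\![\varphi]\!]^{U,V}$. -}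

module Defs where

open import Data.Bool.Base as Bool using (Bool; true)
open import Data.Product.Base using (_×_; Σ-syntax)
open import Level using (Level; 0ℓ; Lift) renaming (suc to lsuc)
open import Relation.Binary.PropositionalEquality.Core using (_≡_)
open import Relation.Nullary.Negation.Core using (¬_)
open import Relation.Unary using (Pred; _∈_; _⊆_; _≐_; _≬_; _∩_; ⋃; ∅; U; Satisfiable)

private
  variable
    ℓ : Level
    PROP : Set

infix  9 ∼_ K_ □_ B_ ◇_
infixr 8 _∧_
infixr 7 _⇒_

data Form (PROP : Set) : Set where
  var : PROP → Form PROP
  ∼_  : Form PROP → Form PROP
  _∧_ : Form PROP → Form PROP → Form PROP
  K_  : Form PROP → Form PROP
  □_  : Form PROP → Form PROP
  B_  : Form PROP → Form PROP

_⇒_ : Form PROP → Form PROP → Form PROP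
φ ⇒ ψ = ∼ (φ ∧ ∼ ψ)

◇_ : Form PROP → Form PROP
◇ φ = ∼ (□ (∼ φ))

-- Boolean evaluation in which primitive propositions and formulas whose main
-- connective is a modality count as propositional atoms, valued by e (the
-- values of e on negations and conjunctions are never used).
eval : (Form PROP → Bool) → Form PROP → Bool
eval e (var p) = e (var p)
eval e (∼ φ)   = Bool.not (eval e φ)
eval e (φ ∧ ψ) = eval e φ Bool.∧ eval e ψ
eval e (K φ)   = e (K φ)
eval e (□ φ)   = e (□ φ)
eval e (B φ)   = e (B φ)

-- Equivalently: a substitution instance of a classical propositional tautology.
Tautology : Form PROP → Set
Tautology {PROP} φ = ∀ (e : Form PROP → Bool) → eval e φ ≡ true

-- A scheme is identified with the set of its instances.
Scheme : Set → Set₁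
Scheme PROP = Pred (Form PROP) 0ℓ

infix 4 EL+_⊢_

-- EL+ A ⊢ φ: provability of φ in the system EL_{K,□,B} + (A).
data EL+_⊢_ {PROP : Set} (A : Scheme PROP) : Form PROP → Set where
  taut   : ∀ {φ} → Tautology φ → EL+ A ⊢ φ
  mp     : ∀ {φ ψ} → EL+ A ⊢ φ ⇒ ψ → EL+ A ⊢ φ → EL+ A ⊢ ψ

  K-dist : ∀ φ ψ → EL+ A ⊢ K (φ ⇒ ψ) ⇒ (K φ ⇒ K ψ)
  K-T    : ∀ φ → EL+ A ⊢ K φ ⇒ φ
  K-4    : ∀ φ → EL+ A ⊢ K φ ⇒ K (K φ)
  K-5    : ∀ φ → EL+ A ⊢ ∼ (K φ) ⇒ K (∼ (K φ))
  K-nec  : ∀ {φ} → EL+ A ⊢ φ → EL+ A ⊢ K φ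

  □-dist : ∀ φ ψ → EL+ A ⊢ □ (φ ⇒ ψ) ⇒ (□ φ ⇒ □ ψ)
  □-T    : ∀ φ → EL+ A ⊢ □ φ ⇒ φ
  □-4    : ∀ φ → EL+ A ⊢ □ φ ⇒ □ (□ φ)
  □-nec  : ∀ {φ} → EL+ A ⊢ φ → EL+ A ⊢ □ φ

  KI     : ∀ φ → EL+ A ⊢ K φ ⇒ □ φ
  K-B    : ∀ φ ψ → EL+ A ⊢ B (φ ⇒ ψ) ⇒ (B φ ⇒ B ψ)
  sPI    : ∀ φ → EL+ A ⊢ B φ ⇒ K (B φ)
  KB     : ∀ φ → EL+ A ⊢ K φ ⇒ B φ
  RB     : ∀ φ → EL+ A ⊢ B φ ⇒ B (□ φ)

  extra  : ∀ {φ} → φ ∈ A → EL+ A ⊢ φ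

data D-B {PROP : Set} : Scheme PROP where
  D-B-instance : ∀ φ → D-B (B φ ⇒ ∼ (B (∼ φ)))

data wF {PROP : Set} : Scheme PROP where
  wF-instance : ∀ φ → wF (B φ ⇒ ◇ φ)

-- Subsets of X are predicates up to _≐_, so being open must respect _≐_.
-- Under excluded middle at level 1 every family of open subsets can be indexed
-- by a small type (subsets then correspond to maps X → Bool), so open-⋃ covers
-- arbitrary unions.
record Topology (X : Set) : Set₂ where
  field
    Open      : Pred (Pred X 0ℓ) (lsuc 0ℓ)
    open-resp : ∀ {P Q} → P ≐ Q → Open P → Open Q
    open-∅    : Open ∅
    open-U    : Open U
    open-∩    : ∀ {P Q} → Open P → Open Q → Open (P ∩ Q)
    open-⋃    : ∀ (I : Set) (P : I → Pred X 0ℓ) →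
                (∀ i → Open (P i)) → Open (⋃ I P)

  int : Pred X ℓ → Pred X (lsuc 0ℓ Level.⊔ ℓ)
  int P x = Σ[ W ∈ Pred X 0ℓ ] Open W × x ∈ W × W ⊆ P

  cl : Pred X ℓ → Pred X (lsuc 0ℓ Level.⊔ ℓ)
  cl P x = ∀ (W : Pred X 0ℓ) → Open W → x ∈ W → W ≬ P

record Model (PROP : Set) : Set₂ where
  field
    X        : Set
    nonempty : X
    topology : Topology X
    v        : PROP → Pred X 0ℓ
  open Topology topology public

-- The fields 𝕌 and 𝕍 are the components U and V of the scenario (x , U , V).
record Scenario (𝒳 : Model PROP) : Set₁ where
  open Model 𝒳
  field
    x      : X
    𝕌 𝕍    : Pred X 0ℓ
    x∈𝕌    : x ∈ 𝕌
    open-𝕌 : Open 𝕌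
    open-𝕍 : Open 𝕍
    𝕍⊆𝕌    : 𝕍 ⊆ 𝕌

Consistent : {𝒳 : Model PROP} → Scenario 𝒳 → Set
Consistent s = Satisfiable 𝕍
  where open Scenario s

Dense : {𝒳 : Model PROP} → Scenario 𝒳 → Set₁
Dense {𝒳 = 𝒳} s = 𝕌 ⊆ cl 𝕍
  where open Model 𝒳
        open Scenario s

-- Truth at (x , 𝕌 , 𝕍), for the model 𝒳. The clauses make sense without the
-- scenario conditions, which are imposed in _⊨_.
module Truth (𝒳 : Model PROP) (𝕌 𝕍 : Pred (Model.X 𝒳) 0ℓ) where
  open Model 𝒳

  mutual
    ⟦_⟧ : Form PROP → Pred X (lsuc 0ℓ)
    ⟦ φ ⟧ y = y ∈ 𝕌 × True φ y

    True : Form PROP → Pred X (lsuc 0ℓ)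
    True (var p) x = Lift (lsuc 0ℓ) (x ∈ v p)
    True (∼ φ)   x = ¬ True φ x
    True (φ ∧ ψ) x = True φ x × True ψ x
    True (K φ)   x = 𝕌 ≐ ⟦ φ ⟧
    True (□ φ)   x = x ∈ int ⟦ φ ⟧
    True (B φ)   x = 𝕍 ⊆ ⟦ φ ⟧

infix 4 _,_⊨_

_,_⊨_ : (𝒳 : Model PROP) → Scenario 𝒳 → Form PROP → Set₁
𝒳 , s ⊨ φ = Truth.True 𝒳 𝕌 𝕍 φ x
  where open Scenario s

{-# OPTIONS --safe #-}

-- Completeness is the canonical model argument. Ordered by □-accessibility, the
-- maximal consistent sets form an S4 frame, whose up-sets are the open sets.
-- For a maximal consistent set t containing ∼ φ, the scenario at t takes for
-- 𝕌 the sets containing {ψ : K ψ ∈ t} and for 𝕍 those containing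
-- {ψ : B ψ ∈ t}; (KI) makes 𝕌 open, (RB) makes 𝕍 open and (KB) gives 𝕍 ⊆ 𝕌.
-- (D_B) says that {ψ : B ψ ∈ t} is consistent, so that 𝕍 is nonempty, and (wF)
-- that it is consistent with {ψ : □ ψ ∈ s} for each s in 𝕌, so that 𝕍 is dense.
module Submission where

open import Defs
open import Axiom.ExcludedMiddle using (ExcludedMiddle)
open import Data.Bool.Base using (Bool; true; false)
open import Data.List.Base using (List; []; _∷_; _++_; map; concat; cartesianProductWith)
open import Data.List.Membership.Propositional using () renaming (_∈_ to _∈ˡ_)
open import Data.List.Membership.Propositional.Properties
  using (∈-++⁺ˡ; ∈-++⁺ʳ; ∈-map⁺; ∈-concat⁺′; ∈-cartesianProductWith⁺)
open import Data.List.Relation.Unary.Any using (here; there)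
open import Data.Nat.Base using (ℕ; zero; suc; _⊔_; _≤_; _≤′_; ≤′-refl; ≤′-step)
open import Data.Nat.Properties using (≤⇒≤′; m≤m⊔n; m≤n⊔m)
open import Data.Product.Base using (_×_; _,_; ∃-syntax; proj₁; proj₂)
open import Data.Sum.Base using (_⊎_; inj₁; inj₂; [_,_])
open import Data.Unit.Base using (tt)
open import Function.Base using (_∘_; id)
open import Function.Bundles using (_⇔_; _↣_; mk⇔; Injection)
open import Level using (0ℓ; lift; lower; Lift) renaming (suc to lsuc)
open import Relation.Binary.PropositionalEquality using (_≡_; refl; sym; trans)
open import Relation.Nullary.Decidable
  using (yes; no; does; map′; dec-true; decidable-stable)
open import Relation.Nullary.Negation.Core using (¬_; contradiction)
open import Relation.Unary using (Pred; _∈_; _∉_; _⊆_; _∪_; ∅; ｛_｝)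

private
  variable
    PROP : Set

-- Propositional tautologies.

⇒-refl-taut : (φ : Form PROP) → Tautology (φ ⇒ φ)
⇒-refl-taut φ e with eval e φ
... | true  = refl
... | false = refl

weakening-taut : (φ ψ : Form PROP) → Tautology (φ ⇒ ψ ⇒ φ)
weakening-taut φ ψ e with eval e φ | eval e ψ
... | true  | true  = refl
... | true  | false = refl
... | false | true  = refl
... | false | false = refl

⇒-distrib-taut : (χ φ ψ : Form PROP) → Tautology ((χ ⇒ φ ⇒ ψ) ⇒ (χ ⇒ φ) ⇒ χ ⇒ ψ)
⇒-distrib-taut χ φ ψ e with eval e χ | eval e φ | eval e ψ
... | true  | true  | true  = refl
... | true  | true  | false = refl
... | true  | false | true  = refl
... | true  | false | false = refl
... | false | true  | true  = refl
... | false | true  | false = refl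
... | false | false | true  = refl
... | false | false | false = refl

excluded-middle-taut : (φ ψ : Form PROP) → Tautology ((φ ⇒ ψ) ⇒ (∼ φ ⇒ ψ) ⇒ ψ)
excluded-middle-taut φ ψ e with eval e φ | eval e ψ
... | true  | true  = refl
... | true  | false = refl
... | false | true  = refl
... | false | false = refl

explosion-taut : (φ ψ : Form PROP) → Tautology (φ ⇒ ∼ φ ⇒ ψ)
explosion-taut φ ψ e with eval e φ | eval e ψ
... | true  | true  = refl
... | true  | false = refl
... | false | true  = refl
... | false | false = refl

reductio-taut : (φ ψ : Form PROP) → Tautology ((φ ⇒ ψ ∧ ∼ ψ) ⇒ ∼ φ)
reductio-taut φ ψ e with eval e φ | eval e ψ
... | true  | true  = refl
... | true  | false = refl
... | false | true  = refl
... | false | false = refl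

∧-intro-taut : (φ ψ : Form PROP) → Tautology (φ ⇒ ψ ⇒ φ ∧ ψ)
∧-intro-taut φ ψ e with eval e φ | eval e ψ
... | true  | true  = refl
... | true  | false = refl
... | false | true  = refl
... | false | false = refl

∧-elimˡ-taut : (φ ψ : Form PROP) → Tautology (φ ∧ ψ ⇒ φ)
∧-elimˡ-taut φ ψ e with eval e φ | eval e ψ
... | true  | true  = refl
... | true  | false = refl
... | false | true  = refl
... | false | false = refl

∧-elimʳ-taut : (φ ψ : Form PROP) → Tautology (φ ∧ ψ ⇒ ψ)
∧-elimʳ-taut φ ψ e with eval e φ | eval e ψ
... | true  | true  = refl
... | true  | false = refl
... | false | true  = refl
... | false | false = refl

∧-combine-taut : (α β φ ψ : Form PROP) →
  Tautology ((α ⇒ φ ⇒ ψ) ⇒ (β ⇒ φ) ⇒ α ∧ β ⇒ ψ)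
∧-combine-taut α β φ ψ e with eval e α | eval e β | eval e φ | eval e ψ
... | true  | true  | true  | true  = refl
... | true  | true  | true  | false = refl
... | true  | true  | false | true  = refl
... | true  | true  | false | false = refl
... | true  | false | true  | true  = refl
... | true  | false | true  | false = refl
... | true  | false | false | true  = refl
... | true  | false | false | false = refl
... | false | true  | true  | true  = refl
... | false | true  | true  | false = refl
... | false | true  | false | true  = refl
... | false | true  | false | false = refl
... | false | false | true  | true  = refl
... | false | false | true  | false = refl
... | false | false | false | true  = refl
... | false | false | false | false = refl

-- Soundness.

module Semantics (em : ExcludedMiddle (lsuc 0ℓ)) (𝒳 : Model PROP)
  (𝕌 𝕍 : Pred (Model.X 𝒳) 0ℓ) where

  open Model 𝒳
  open Truth 𝒳 𝕌 𝕍

  ⇒⁻ : {P Q : Set₁} → ¬ (P × ¬ Q) → P → Q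
  ⇒⁻ f a = decidable-stable em λ ¬b → f (a , ¬b)

  truthValue : X → Form PROP → Bool
  truthValue x φ = does (em {P = True φ x})

  -- `eval` consults its valuation at modal formulas, so the induction stops there. Hence the truth
  -- values at a point come from a Boolean valuation, which makes tautologies true.
  eval-truthValue : ∀ x φ → eval (truthValue x) φ ≡ truthValue x φ
  eval-truthValue x (var p) = refl
  eval-truthValue x (∼ φ) rewrite eval-truthValue x φ
    with em {P = True φ x} | em {P = True (∼ φ) x}
  ... | yes a | yes b = contradiction a b
  ... | yes a | no  b = refl
  ... | no  a | yes b = refl
  ... | no  a | no  b = contradiction a b
  eval-truthValue x (φ ∧ ψ) rewrite eval-truthValue x φ | eval-truthValue x ψ
    with em {P = True φ x} | em {P = True ψ x} | em {P = True (φ ∧ ψ) x}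
  ... | yes a | yes b | yes c = refl
  ... | yes a | yes b | no  c = contradiction (a , b) c
  ... | yes a | no  b | yes c = contradiction (proj₂ c) b
  ... | yes a | no  b | no  c = refl
  ... | no  a | _     | yes c = contradiction (proj₁ c) a
  ... | no  a | _     | no  c = refl
  eval-truthValue x (K φ) = refl
  eval-truthValue x (□ φ) = refl
  eval-truthValue x (B φ) = refl

  tautology-True : ∀ {φ} → Tautology φ → ∀ x → True φ x
  tautology-True {φ} t x
    with em {P = True φ x} | trans (sym (eval-truthValue x φ)) (t (truthValue x))
  ... | yes a | _ = a

  -- The necessitation rules force the induction to cover all points of `𝕌` at once. `𝕌` and `𝕍`
  -- stay fixed, so consistency or density of one scenario is enough to validate the extra scheme.
  soundness : ∀ {A} → Open 𝕌 → Open 𝕍 → 𝕍 ⊆ 𝕌 →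
    (∀ {φ} → φ ∈ A → ∀ {x} → x ∈ 𝕌 → True φ x) →
    ∀ {φ} → EL+ A ⊢ φ → ∀ {x} → x ∈ 𝕌 → True φ x
  soundness {A} open-𝕌 open-𝕍 𝕍⊆𝕌 sound-A = sound
    where
    sound : ∀ {φ} → EL+ A ⊢ φ → ∀ {x} → x ∈ 𝕌 → True φ x
    sound (taut t) _ = tautology-True t _
    sound (mp p q) x∈𝕌 = ⇒⁻ (sound p x∈𝕌) (sound q x∈𝕌)
    sound (K-dist φ ψ) _ ((f , _) , ¬k) = ¬k λ ((a , _) , ¬k′) →
      ¬k′ ((λ y → y , ⇒⁻ (proj₂ (f y)) (proj₂ (a y))) , proj₁)
    sound (K-T φ) x∈𝕌 ((a , _) , ¬φ) = ¬φ (proj₂ (a x∈𝕌))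
    sound (K-4 φ) _ (k , ¬kk) = ¬kk ((λ y → y , k) , proj₁)
    sound (K-5 φ) _ (¬k , ¬k¬k) = ¬k¬k ((λ y → y , ¬k) , proj₁)
    sound (K-nec p) _ = (λ y → y , sound p y) , proj₁
    sound (□-dist φ ψ) _ ((W , oW , x∈W , W⊆) , ¬i) =
      ¬i λ ((W′ , oW′ , x∈W′ , W′⊆) , ¬i′) →
      ¬i′ (_ , open-∩ oW oW′ , (x∈W , x∈W′) ,
           λ (y , y′) → proj₁ (W⊆ y) , ⇒⁻ (proj₂ (W⊆ y)) (proj₂ (W′⊆ y′)))
    sound (□-T φ) _ ((W , oW , x∈W , W⊆) , ¬φ) = ¬φ (proj₂ (W⊆ x∈W))
    sound (□-4 φ) _ ((W , oW , x∈W , W⊆) , ¬i) =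
      ¬i (W , oW , x∈W , λ y → proj₁ (W⊆ y) , W , oW , y , W⊆)
    sound (□-nec p) x∈𝕌 = 𝕌 , open-𝕌 , x∈𝕌 , λ y → y , sound p y
    sound (KI φ) x∈𝕌 ((a , _) , ¬i) = ¬i (𝕌 , open-𝕌 , x∈𝕌 , a)
    sound (K-B φ ψ) _ (f , ¬b) = ¬b λ (a , ¬b′) →
      ¬b′ λ y → 𝕍⊆𝕌 y , ⇒⁻ (proj₂ (f y)) (proj₂ (a y))
    sound (sPI φ) _ (b , ¬k) = ¬k ((λ y → y , b) , proj₁)
    sound (KB φ) _ ((a , _) , ¬b) = ¬b λ y → a (𝕍⊆𝕌 y)
    -- The open set `𝕍` is itself the neighbourhood witnessing `□ φ` at its points.
    sound (RB φ) _ (b , ¬b′) = ¬b′ λ y → 𝕍⊆𝕌 y , 𝕍 , open-𝕍 , y , b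
    sound (extra a) x∈𝕌 = sound-A a x∈𝕌

D-B-sound : ExcludedMiddle (lsuc 0ℓ) → {φ : Form PROP} → EL+ D-B ⊢ φ →
  ∀ 𝒳 (s : Scenario 𝒳) → Consistent s → 𝒳 , s ⊨ φ
D-B-sound em p 𝒳 s (_ , z∈𝕍) = soundness open-𝕌 open-𝕍 𝕍⊆𝕌 D-B-True p x∈𝕌
  where
  open Scenario s
  open Semantics em 𝒳 𝕌 𝕍
  open Truth 𝒳 𝕌 𝕍

  D-B-True : ∀ {φ} → φ ∈ D-B → ∀ {y} → y ∈ 𝕌 → True φ y
  D-B-True (D-B-instance φ) _ (b , ¬¬b′) =
    ¬¬b′ λ b′ → proj₂ (b′ z∈𝕍) (proj₂ (b z∈𝕍))

wF-sound : ExcludedMiddle (lsuc 0ℓ) → {φ : Form PROP} → EL+ wF ⊢ φ →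
  ∀ 𝒳 (s : Scenario 𝒳) → Dense s → 𝒳 , s ⊨ φ
wF-sound em p 𝒳 s dense = soundness open-𝕌 open-𝕍 𝕍⊆𝕌 wF-True p x∈𝕌
  where
  open Scenario s
  open Semantics em 𝒳 𝕌 𝕍
  open Truth 𝒳 𝕌 𝕍

  wF-True : ∀ {φ} → φ ∈ wF → ∀ {y} → y ∈ 𝕌 → True φ y
  wF-True (wF-instance φ) y∈𝕌 (b , ¬◇) = ¬◇ λ (W , oW , y∈W , W⊆) →
    -- Density puts a point of `𝕍`, where `φ` holds, into a neighbourhood on which `φ` fails.
    let z , z∈W , z∈𝕍 = dense y∈𝕌 W oW y∈W
    in proj₂ (W⊆ z∈W) (proj₂ (b z∈𝕍))

-- Enumeration of formulas.

module Enumeration (atoms : ℕ → List PROP) where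

  -- The lists are cumulative, so that both parts of a conjunction meet in a common list. The
  -- Lindenbaum construction treats one whole list per stage.
  formulas : ℕ → List (Form PROP)
  compounds : ℕ → List (List (Form PROP))

  formulas zero    = []
  formulas (suc n) = formulas n ++ concat (compounds n)

  compounds n =
      map var (atoms n)
    ∷ map ∼_ (formulas n)
    ∷ cartesianProductWith _∧_ (formulas n) (formulas n)
    ∷ map K_ (formulas n)
    ∷ map □_ (formulas n)
    ∷ map B_ (formulas n)
    ∷ []

  formulas-mono′ : ∀ {m n φ} → m ≤′ n → φ ∈ˡ formulas m → φ ∈ˡ formulas n
  formulas-mono′ ≤′-refl     i = i
  formulas-mono′ (≤′-step p) i = ∈-++⁺ˡ (formulas-mono′ p i)

  formulas-mono : ∀ {m n φ} → m ≤ n → φ ∈ˡ formulas m → φ ∈ˡ formulas n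
  formulas-mono p = formulas-mono′ (≤⇒≤′ p)

  formulas-complete : (∀ p → ∃[ n ] p ∈ˡ atoms n) → ∀ φ → ∃[ n ] φ ∈ˡ formulas n
  formulas-complete ∈-atoms = go
    where
    new : ∀ n {φ φs} → φ ∈ˡ φs → φs ∈ˡ compounds n → φ ∈ˡ formulas (suc n)
    new n i j = ∈-++⁺ʳ (formulas n) (∈-concat⁺′ i j)

    go : ∀ φ → ∃[ n ] φ ∈ˡ formulas n
    go (var p) with n , i ← ∈-atoms p =
      suc n , new n (∈-map⁺ var i) (here refl)
    go (∼ φ) with n , i ← go φ =
      suc n , new n (∈-map⁺ ∼_ i) (there (here refl))
    go (φ ∧ ψ) with m , i ← go φ | n , j ← go ψ =
      suc (m ⊔ n) ,
      new (m ⊔ n)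
        (∈-cartesianProductWith⁺ _∧_ (formulas-mono (m≤m⊔n m n) i)
                                     (formulas-mono (m≤n⊔m m n) j))
        (there (there (here refl)))
    go (K φ) with n , i ← go φ =
      suc n , new n (∈-map⁺ K_ i) (there (there (there (here refl))))
    go (□ φ) with n , i ← go φ =
      suc n , new n (∈-map⁺ □_ i) (there (there (there (there (here refl)))))
    go (B φ) with n , i ← go φ =
      suc n , new n (∈-map⁺ B_ i) (there (there (there (there (there (here refl))))))

-- Derivations from hypotheses and maximal consistent sets.

module Derivation {PROP : Set} (A : Scheme PROP) where

  private
    variable
      φ ψ χ : Form PROP
      Γ Δ   : Pred (Form PROP) 0ℓ

  infix 4 _⊩_

  -- Necessitation applies to theorems only, hence the deduction theorem.
  data _⊩_ (Γ : Pred (Form PROP) 0ℓ) : Form PROP → Set where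
    hyp : φ ∈ Γ → Γ ⊩ φ
    thm : EL+ A ⊢ φ → Γ ⊩ φ
    mp  : Γ ⊩ φ ⇒ ψ → Γ ⊩ φ → Γ ⊩ ψ

  ⊩-mono : Γ ⊆ Δ → Γ ⊩ φ → Δ ⊩ φ
  ⊩-mono s (hyp i)  = hyp (s i)
  ⊩-mono s (thm p)  = thm p
  ⊩-mono s (mp d e) = mp (⊩-mono s d) (⊩-mono s e)

  ⊩-taut : Tautology φ → Γ ⊩ φ
  ⊩-taut t = thm (taut t)

  deduction : Γ ∪ ｛ ψ ｝ ⊩ φ → Γ ⊩ ψ ⇒ φ
  deduction {ψ = ψ} {φ} (hyp (inj₁ i)) = mp (⊩-taut (weakening-taut φ ψ)) (hyp i)
  deduction {ψ = ψ} (hyp (inj₂ refl)) = ⊩-taut (⇒-refl-taut ψ)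
  deduction {ψ = ψ} {φ} (thm p) = mp (⊩-taut (weakening-taut φ ψ)) (thm p)
  deduction {ψ = ψ} {φ} (mp {φ = χ} d e) =
    mp (mp (⊩-taut (⇒-distrib-taut ψ χ φ)) (deduction d)) (deduction e)

  -- A derivation uses finitely many hypotheses; at each `mp` the later of two stages contains those
  -- of both premises.
  compactness : (Γ : ℕ → Pred (Form PROP) 0ℓ) →
    (∀ {m n} → m ≤ n → Γ m ⊆ Γ n) →
    (λ ψ → ∃[ n ] ψ ∈ Γ n) ⊩ φ → ∃[ n ] Γ n ⊩ φ
  compactness Γ mono (hyp (n , i)) = n , hyp i
  compactness Γ mono (thm p)       = zero , thm p
  compactness Γ mono (mp d e)
    with m , d′ ← compactness Γ mono d | n , e′ ← compactness Γ mono e =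
    m ⊔ n , mp (⊩-mono (mono (m≤m⊔n m n)) d′) (⊩-mono (mono (m≤n⊔m m n)) e′)

  -- A maximal consistent set, given by its characteristic function.
  record World : Set where
    field
      member : Form PROP → Bool

    infix 4 ∋_
    ∋_ : Form PROP → Set
    ∋ φ = member φ ≡ true

    field
      theorem    : EL+ A ⊢ φ → ∋ φ
      detach     : ∋ φ ⇒ ψ → ∋ φ → ∋ ψ
      consistent : ∋ φ → ¬ ∋ ∼ φ
      complete   : ¬ ∋ φ → ∋ ∼ φ

    apply : EL+ A ⊢ φ ⇒ ψ → ∋ φ → ∋ ψ
    apply p = detach (theorem p)

    ∧-intro : ∋ φ → ∋ ψ → ∋ φ ∧ ψ
    ∧-intro {φ} {ψ} i j = detach (apply (taut (∧-intro-taut φ ψ)) i) j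

  infix 4 _∋_
  _∋_ : World → Form PROP → Set
  S ∋ φ = World.∋_ S φ

  open World using (theorem; detach; consistent; complete; apply; ∧-intro)

  -- Normal modalities.

  record Normal (○_ : Form PROP → Form PROP) : Set where
    field
      distrib     : EL+ A ⊢ ○ (φ ⇒ ψ) ⇒ (○ φ ⇒ ○ ψ)
      necessitate : EL+ A ⊢ φ → EL+ A ⊢ ○ φ

    -- The derivation is replayed under the modality: theorems are necessitated, and `mp` goes
    -- through by distribution.
    boxed-⊩ : (S : World) → (λ ψ → S ∋ ○ ψ) ⊩ φ → S ∋ ○ φ
    boxed-⊩ S (hyp i)  = i
    boxed-⊩ S (thm p)  = theorem S (necessitate p)
    boxed-⊩ S (mp d e) = detach S (apply S distrib (boxed-⊩ S d)) (boxed-⊩ S e)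

  open Normal using (necessitate; boxed-⊩)

  K-normal : Normal K_
  K-normal = record { distrib = K-dist _ _ ; necessitate = K-nec }

  □-normal : Normal □_
  □-normal = record { distrib = □-dist _ _ ; necessitate = □-nec }

  -- Necessitation for `B` comes from that for `K` through (KB).
  B-normal : Normal B_
  B-normal = record { distrib = K-B _ _ ; necessitate = λ p → mp (KB _) (K-nec p) }

  -- Prepares density: the believed hypotheses of a derivation are gathered into one formula `α`,
  -- believed because `B` is normal, so that only boxed hypotheses remain and (wF) can be applied to
  -- `α`.
  belief-⊩ : (S : World) → (λ ψ → S ∋ □ ψ ⊎ S ∋ B ψ) ⊩ φ →
    ∃[ α ] S ∋ B α × (λ ψ → S ∋ □ ψ) ⊩ α ⇒ φ
  belief-⊩ {φ} S (hyp (inj₁ i)) =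
    -- The hypothesis is boxed already, so a believed theorem serves as `α`.
    φ ⇒ φ , theorem S (necessitate B-normal (taut (⇒-refl-taut φ))) ,
    mp (⊩-taut (weakening-taut φ (φ ⇒ φ))) (hyp i)
  belief-⊩ {φ} S (hyp (inj₂ i)) = φ , i , ⊩-taut (⇒-refl-taut φ)
  belief-⊩ {φ} S (thm p) =
    φ , theorem S (necessitate B-normal p) , ⊩-taut (⇒-refl-taut φ)
  belief-⊩ {φ} S (mp {φ = χ} d e)
    with α , i , d′ ← belief-⊩ S d | β , j , e′ ← belief-⊩ S e =
    α ∧ β ,
    boxed-⊩ B-normal S (mp (mp (⊩-taut (∧-intro-taut α β)) (hyp i)) (hyp j)) ,
    mp (mp (⊩-taut (∧-combine-taut α β χ φ)) d′) e′

  -- The canonical model.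

  infix 5 _⟶_

  _⟶_ : World → World → Set
  S ⟶ T = ∀ {ψ} → S ∋ □ ψ → T ∋ ψ

  ⟶-refl : ∀ S → S ⟶ S
  ⟶-refl S = apply S (□-T _)

  ⟶-trans : ∀ S T R → S ⟶ T → T ⟶ R → S ⟶ R
  ⟶-trans S T R r r′ i = r′ (r (apply S (□-4 _) i))

  -- The Alexandrov topology of the preorder `⟶`: the successors of a world form its least open
  -- neighbourhood, so interior is the Kripke box.
  up-sets : Topology World
  up-sets = record
    { Open      = λ P → Lift (lsuc 0ℓ) (∀ {S T} → S ⟶ T → S ∈ P → T ∈ P)
    ; open-resp = λ (P⊆Q , Q⊆P) o → lift λ r → P⊆Q ∘ lower o r ∘ Q⊆P
    ; open-∅    = lift λ _ ()
    ; open-U    = lift λ _ _ → tt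
    ; open-∩    = λ o o′ → lift λ r (i , j) → lower o r i , lower o′ r j
    ; open-⋃    = λ I P o → lift λ r (i , j) → i , lower (o i) r j
    }

  canonicalModel : World → Model PROP
  canonicalModel t = record
    { X        = World
    ; nonempty = t
    ; topology = up-sets
    ; v        = λ p S → S ∋ var p
    }

  canonicalScenario : (t : World) → Scenario (canonicalModel t)
  canonicalScenario t = record
    { x      = t
    ; 𝕌      = λ S → ∀ {ψ} → t ∋ K ψ → S ∋ ψ
    ; 𝕍      = λ S → ∀ {ψ} → t ∋ B ψ → S ∋ ψ
    ; x∈𝕌    = apply t (K-T _)
    -- By (K-4), `K ψ` itself is in `S`, and (KI) turns it into `□ ψ`, which passes `ψ` to
    -- successors.
    ; open-𝕌 = lift λ {S} r S∈𝕌 i → r (apply S (KI _) (S∈𝕌 (apply t (K-4 _) i)))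
    ; open-𝕍 = lift λ r S∈𝕍 i → r (S∈𝕍 (apply t (RB _) i))
    ; 𝕍⊆𝕌    = λ S∈𝕍 i → S∈𝕍 (apply t (KB _) i)
    }

  -- Lindenbaum's lemma.

  module Canonical (em₀ : ExcludedMiddle 0ℓ)
    (atoms : ℕ → List PROP) (∈-atoms : ∀ p → ∃[ n ] p ∈ˡ atoms n) where

    open Enumeration atoms

    module Lindenbaum (Γ : Pred (Form PROP) 0ℓ) (φ : Form PROP) where

      -- The invariant is that `φ` stays underivable. Placing this condition inside membership
      -- defines the extension without a case split on `em₀`.
      extend : Pred (Form PROP) 0ℓ → Form PROP → Pred (Form PROP) 0ℓ
      extend Δ ψ χ = χ ∈ Δ ⊎ (ψ ≡ χ × ¬ (Δ ∪ ｛ ψ ｝ ⊩ φ))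

      extend-⊮ : ¬ (Δ ⊩ φ) → ¬ (extend Δ ψ ⊩ φ)
      extend-⊮ {Δ} {ψ} Δ⊮φ d with em₀ {P = Δ ∪ ｛ ψ ｝ ⊩ φ}
      ... | yes e = Δ⊮φ (⊩-mono [ id , (λ (_ , ¬e) → contradiction e ¬e) ] d)
      ... | no ¬e = ¬e (⊩-mono [ inj₁ , inj₂ ∘ proj₁ ] d)

      extendAll : Pred (Form PROP) 0ℓ → List (Form PROP) → Pred (Form PROP) 0ℓ
      extendAll Δ []       = Δ
      extendAll Δ (ψ ∷ ψs) = extendAll (extend Δ ψ) ψs

      extendAll-⊇ : ∀ ψs → Δ ⊆ extendAll Δ ψs
      extendAll-⊇ []       i = i
      extendAll-⊇ (ψ ∷ ψs) i = extendAll-⊇ ψs (inj₁ i)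

      extendAll-⊮ : ∀ ψs → ¬ (Δ ⊩ φ) → ¬ (extendAll Δ ψs ⊩ φ)
      extendAll-⊮ []       Δ⊮φ = Δ⊮φ
      extendAll-⊮ (ψ ∷ ψs) Δ⊮φ = extendAll-⊮ ψs (extend-⊮ Δ⊮φ)

      -- When `ψ` is rejected, the deduction theorem yields `ψ ⇒ φ` at that moment, and this remains
      -- derivable from all later sets.
      extendAll-decides : ∀ {ψs} → ψ ∈ˡ ψs →
        ψ ∈ extendAll Δ ψs ⊎ extendAll Δ ψs ⊩ ψ ⇒ φ
      extendAll-decides {ψ} {Δ} {_ ∷ ψs} (here refl) with em₀ {P = Δ ∪ ｛ ψ ｝ ⊩ φ}
      ... | yes e = inj₂ (⊩-mono (extendAll-⊇ ψs ∘ inj₁) (deduction e))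
      ... | no ¬e = inj₁ (extendAll-⊇ ψs (inj₂ (refl , ¬e)))
      extendAll-decides (there i) = extendAll-decides i

      stage : ℕ → Pred (Form PROP) 0ℓ
      stage zero    = Γ
      stage (suc n) = extendAll (stage n) (formulas n)

      stage-mono′ : ∀ {m n} → m ≤′ n → stage m ⊆ stage n
      stage-mono′ ≤′-refl             i = i
      stage-mono′ (≤′-step {n = n} p) i = extendAll-⊇ (formulas n) (stage-mono′ p i)

      stage-mono : ∀ {m n} → m ≤ n → stage m ⊆ stage n
      stage-mono p = stage-mono′ (≤⇒≤′ p)

      limit : Pred (Form PROP) 0ℓ
      limit ψ = ∃[ n ] ψ ∈ stage n

      module _ (Γ⊮φ : ¬ (Γ ⊩ φ)) where

        stage-⊮ : ∀ n → ¬ (stage n ⊩ φ)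
        stage-⊮ zero    = Γ⊮φ
        stage-⊮ (suc n) = extendAll-⊮ (formulas n) (stage-⊮ n)

        limit-⊮ : ¬ (limit ⊩ φ)
        limit-⊮ d with n , d′ ← compactness stage stage-mono d = stage-⊮ n d′

        limit-decides : ∀ ψ → ψ ∈ limit ⊎ limit ⊩ ψ ⇒ φ
        limit-decides ψ with n , i ← formulas-complete ∈-atoms ψ
          with extendAll-decides {Δ = stage n} i
        ... | inj₁ j = inj₁ (suc n , j)
        ... | inj₂ d = inj₂ (⊩-mono (suc n ,_) d)

        limit-closed : limit ⊩ ψ → ψ ∈ limit
        limit-closed {ψ} d with limit-decides ψ
        ... | inj₁ i = i
        ... | inj₂ e = contradiction (mp e d) limit-⊮

        limit-complete : ψ ∉ limit → ∼ ψ ∈ limit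
        limit-complete {ψ} ψ∉ with limit-decides ψ | limit-decides (∼ ψ)
        ... | inj₁ i | _      = contradiction i ψ∉
        ... | inj₂ _ | inj₁ j = j
        -- Were `ψ` and `∼ ψ` both rejected, each would imply `φ`, making `φ` derivable.
        ... | inj₂ d | inj₂ e =
          contradiction (mp (mp (⊩-taut (excluded-middle-taut ψ φ)) d) e) limit-⊮

        limit-consistent : ψ ∈ limit → ∼ ψ ∉ limit
        limit-consistent {ψ} i j =
          limit-⊮ (mp (mp (⊩-taut (explosion-taut ψ φ)) (hyp i)) (hyp j))

        -- Bool-valued membership keeps `World` in `Set`, as the carrier of a `Model` must be;
        -- excluded middle decides the limit.
        characteristic : Form PROP → Bool
        characteristic ψ = does (em₀ {P = ψ ∈ limit})

        characteristic⁺ : ψ ∈ limit → characteristic ψ ≡ true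
        characteristic⁺ = dec-true em₀

        characteristic⁻ : characteristic ψ ≡ true → ψ ∈ limit
        characteristic⁻ {ψ} eq with yes i ← em₀ {P = ψ ∈ limit} = i

        world : World
        world = record
          { member     = characteristic
          ; theorem    = λ p → characteristic⁺ (limit-closed (thm p))
          ; detach     = λ i j → characteristic⁺
              (limit-closed (mp (hyp (characteristic⁻ i)) (hyp (characteristic⁻ j))))
          ; consistent = λ i j →
              limit-consistent (characteristic⁻ i) (characteristic⁻ j)
          ; complete   = λ ¬i → characteristic⁺ (limit-complete (¬i ∘ characteristic⁺))
          }

    lindenbaum : ¬ (Γ ⊩ φ) → ∃[ S ] (∀ {ψ} → ψ ∈ Γ → S ∋ ψ) × ¬ S ∋ φ
    lindenbaum {Γ} {φ} Γ⊮φ =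
      world Γ⊮φ ,
      (λ i → characteristic⁺ Γ⊮φ (zero , i)) ,
      λ i → limit-⊮ Γ⊮φ (hyp (characteristic⁻ Γ⊮φ i))
      where open Lindenbaum Γ φ

    -- The existence lemma, for all three modalities at once: were `φ` derivable from the unboxed
    -- formulas, `boxed-⊩` would put `○ φ` into `S`.
    witness : ∀ {○_} → Normal ○_ → (S : World) → ¬ S ∋ ○ φ →
      ∃[ T ] (∀ {ψ} → S ∋ ○ ψ → T ∋ ψ) × ¬ T ∋ φ
    witness nrm S ∌○φ = lindenbaum (∌○φ ∘ boxed-⊩ nrm S)

    -- The truth lemma.

    module _ (t : World) where
      open Scenario (canonicalScenario t)
      open Truth (canonicalModel t) 𝕌 𝕍

      -- If `t` lacked `K φ`, negative introspection would give `K (∼ (K φ))` in `t` and so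
      -- `∼ (K φ)` in `S`.
      K-invariant : ∀ S → S ∈ 𝕌 → S ∋ K φ → t ∋ K φ
      K-invariant S S∈𝕌 i = decidable-stable em₀ λ ¬i →
        consistent S i (S∈𝕌 (apply t (K-5 _) (complete t ¬i)))

      -- (sPI) turns the belief into knowledge of it, which `K-invariant` carries back to `t`.
      B-invariant : ∀ S → S ∈ 𝕌 → S ∋ B φ → t ∋ B φ
      B-invariant S S∈𝕌 i = apply t (K-T _) (K-invariant S S∈𝕌 (apply S (sPI _) i))

      -- The two directions are proved together because negation exchanges them. Only worlds in `𝕌`
      -- qualify, since there the `K` and `B` formulas agree with those of `t`.
      truth⁺ : ∀ φ S → S ∈ 𝕌 → S ∋ φ → True φ S
      truth⁻ : ∀ φ S → S ∈ 𝕌 → True φ S → S ∋ φ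

      truth⁺ (var p) S S∈𝕌 i = lift i
      truth⁺ (∼ φ) S S∈𝕌 i a = consistent S (truth⁻ φ S S∈𝕌 a) i
      truth⁺ (φ ∧ ψ) S S∈𝕌 i =
        truth⁺ φ S S∈𝕌 (apply S (taut (∧-elimˡ-taut φ ψ)) i) ,
        truth⁺ ψ S S∈𝕌 (apply S (taut (∧-elimʳ-taut φ ψ)) i)
      truth⁺ (K φ) S S∈𝕌 i =
        (λ {T} T∈𝕌 → T∈𝕌 , truth⁺ φ T T∈𝕌 (T∈𝕌 (K-invariant S S∈𝕌 i))) , proj₁
      truth⁺ (□ φ) S S∈𝕌 i =
        -- The least open neighbourhood of `S`; it lies in `𝕌` because `𝕌` is open.
        S ⟶_ , lift (λ {T} {R} r′ r → ⟶-trans S T R r r′) , ⟶-refl S ,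
        λ {T} r → let T∈𝕌 = lower open-𝕌 {S} {T} r S∈𝕌
                  in T∈𝕌 , truth⁺ φ T T∈𝕌 (r i)
      truth⁺ (B φ) S S∈𝕌 i {T} T∈𝕍 =
        let T∈𝕌 = 𝕍⊆𝕌 {T} T∈𝕍
        in T∈𝕌 , truth⁺ φ T T∈𝕌 (T∈𝕍 (B-invariant S S∈𝕌 i))

      truth⁻ (var p) S S∈𝕌 (lift i) = i
      truth⁻ (∼ φ) S S∈𝕌 ¬a = complete S (¬a ∘ truth⁺ φ S S∈𝕌)
      truth⁻ (φ ∧ ψ) S S∈𝕌 (a , b) = ∧-intro S (truth⁻ φ S S∈𝕌 a) (truth⁻ ψ S S∈𝕌 b)
      truth⁻ (K φ) S S∈𝕌 (𝕌⊆ , _) =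
        -- It suffices to find `K φ` in `t`, since (K-4) passes it to `S`; otherwise some world of
        -- `𝕌` would omit `φ`.
        S∈𝕌 (apply t (K-4 φ) (decidable-stable em₀ λ ∌Kφ →
          let T , T∈𝕌 , ∌φ = witness K-normal t ∌Kφ
          in ∌φ (truth⁻ φ T T∈𝕌 (proj₂ (𝕌⊆ {T} T∈𝕌)))))
      truth⁻ (□ φ) S S∈𝕌 (W , oW , S∈W , W⊆) = decidable-stable em₀ λ ∌□φ →
        -- The successor `T` omitting `φ` lies in every open set around `S`, in particular in `W`.
        let T , r , ∌φ = witness □-normal S ∌□φ
            T∈𝕌 , a    = W⊆ (lower oW r S∈W)
        in ∌φ (truth⁻ φ T T∈𝕌 a)
      truth⁻ (B φ) S S∈𝕌 𝕍⊆ =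
        S∈𝕌 (apply t (sPI φ) (decidable-stable em₀ λ ∌Bφ →
          let T , T∈𝕍 , ∌φ = witness B-normal t ∌Bφ
              T∈𝕌 , a      = 𝕍⊆ {T} T∈𝕍
          in ∌φ (truth⁻ φ T T∈𝕌 a)))

    completeness :
      (∀ t → canonicalModel t , canonicalScenario t ⊨ φ) → EL+ A ⊢ φ
    completeness {φ} valid = ∅-⊩ (decidable-stable em₀ λ ⊮φ →
      let t , _ , ∌φ = lindenbaum ⊮φ in ∌φ (truth⁻ t φ t (apply t (K-T _)) (valid t)))
      where
      ∅-⊩ : ∅ ⊩ ψ → EL+ A ⊢ ψ
      ∅-⊩ (thm p)  = p
      ∅-⊩ (mp d e) = mp (∅-⊩ d) (∅-⊩ e)

-- Completeness of the two systems.

module _ (em : ExcludedMiddle (lsuc 0ℓ)) (PROP↣ℕ : PROP ↣ ℕ) where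

  open Injection PROP↣ℕ using (to; injective)

  em₀ : ExcludedMiddle 0ℓ
  em₀ = map′ lower lift (em {P = Lift (lsuc 0ℓ) _})

  -- The fibre of the injection over `n`, with at most one element; the empty list covers numbers
  -- outside its image.
  atoms : ℕ → List PROP
  atoms n with em₀ {P = ∃[ p ] to p ≡ n}
  ... | yes (p , _) = p ∷ []
  ... | no _        = []

  ∈-atoms : ∀ p → ∃[ n ] p ∈ˡ atoms n
  ∈-atoms p = to p , p∈
    where
    p∈ : p ∈ˡ atoms (to p)
    p∈ with em₀ {P = ∃[ q ] to q ≡ to p}
    ... | yes (q , eq) = here (sym (injective eq))
    ... | no ¬p        = contradiction (p , refl) ¬p

  D-B-complete : ∀ {φ} →
    (∀ 𝒳 (s : Scenario 𝒳) → Consistent s → 𝒳 , s ⊨ φ) → EL+ D-B ⊢ φ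
  D-B-complete {φ} valid = completeness λ t → valid _ (canonicalScenario t) (inhabited t)
    where
    open Derivation D-B
    open World
    open Canonical em₀ atoms ∈-atoms

    -- If `t` believed a contradiction, (D_B) would deny belief in its negation, a theorem and hence
    -- believed. So the existence lemma supplies a world of `𝕍`.
    inhabited : ∀ t → Consistent (canonicalScenario t)
    inhabited t = let T , T∈𝕍 , _ = witness B-normal t ∌B⊥ in T , T∈𝕍
      where
      ∌B⊥ : ¬ t ∋ B (φ ∧ ∼ φ)
      -- ∼ (φ ∧ ∼ φ) unfolds to φ ⇒ φ.
      ∌B⊥ i = consistent t
        (theorem t (Normal.necessitate B-normal (taut (⇒-refl-taut φ))))
        (apply t (extra (D-B-instance _)) i)

  wF-complete : ∀ {φ} →
    (∀ 𝒳 (s : Scenario 𝒳) → Dense s → 𝒳 , s ⊨ φ) → EL+ wF ⊢ φ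
  wF-complete {φ} valid = completeness λ t → valid _ (canonicalScenario t) (dense t)
    where
    open Derivation wF
    open World
    open Canonical em₀ atoms ∈-atoms

    dense : ∀ t → Dense (canonicalScenario t)
    dense t {S} S∈𝕌 W oW S∈W =
      let T , Γ⊆T , _ = lindenbaum ⊮⊥
      -- The boxed part makes `T` a successor of `S`, hence in `W`. By (sPI) all beliefs of `t` are
      -- beliefs of `S`, so `T` is in `𝕍`.
      in T , lower oW (Γ⊆T ∘ inj₁) S∈W , Γ⊆T ∘ inj₂ ∘ S∈𝕌 ∘ apply t (sPI _)
      where
      -- Otherwise the boxed formulas of `S` would refute some believed `α`, giving `□ (∼ α)` in `S`
      -- against the `◇ α` supplied by (wF).
      ⊮⊥ : ¬ ((λ ψ → S ∋ □ ψ ⊎ S ∋ B ψ) ⊩ φ ∧ ∼ φ)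
      ⊮⊥ d with α , i , e ← belief-⊩ S d =
        consistent S
          (Normal.boxed-⊩ □-normal S (mp (⊩-taut (reductio-taut α φ)) e))
          (apply S (extra (wF-instance α)) i)

theorem9 : ExcludedMiddle (lsuc 0ℓ) →
    (PROP : Set) → PROP ↣ ℕ →
    ((φ : Form PROP) →
    (EL+ D-B ⊢ φ) ⇔
    ((𝒳 : Model PROP) (s : Scenario 𝒳) → Consistent s → 𝒳 , s ⊨ φ))
    ×
    ((φ : Form PROP) →
    (EL+ wF ⊢ φ) ⇔
    ((𝒳 : Model PROP) (s : Scenario 𝒳) → Dense s → 𝒳 , s ⊨ φ))
theorem9 em PROP PROP↣ℕ =
  (λ φ → mk⇔ (D-B-sound em) (D-B-complete em PROP↣ℕ)) ,
  (λ φ → mk⇔ (wF-sound em) (wF-complete em PROP↣ℕ))
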